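{- For integers $\ell\geq b\geq0$ we have the identity $$\frac{\partial\hat R^{(b)}}{\partial\hat x_\ell}=I(b,\ell;\hat R^{(b)})\,\frac{\partial\hat R^{(b)}}{\partial\hat x_b}.$$
   Context: Define the formal power series in $r$ $$I(b,\ell;r)=\sum_{p=0}^\infty\frac{r^p}{(p!)^2}\prod_{m=0}^{p-1}(\ell^2-(b-m)^2),\qquad J(b;r)=\sum_{p=1}^\infty\frac{(-1)^{p+1}r^p}{p!(p-1)!}\prod_{m=0}^{p-2}(b-m)(b-m-1).$$ $\hat R^{(b)}(\hat x_b,\hat x_{b+1},\ldots)$ is the unique formal power series with zero constant term such that $J(b;\hat R^{(b)})-\sum_{\ell=b}^\infty I(b,\ell;\hat R^{(b)})\,\hat x_\ell=0$. -}

module Defs where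

open import Data.Nat as ℕ using (ℕ; zero; suc; _≤_; _<_; s≤s; _∸_; _!)
import Data.Nat.Properties as ℕₚ
open import Data.Nat.Properties using (_!*_!≢0)
open import Data.Integer as ℤ using (ℤ; +_; -[1+_])
open import Data.Rational as ℚ using (ℚ; 0ℚ; 1ℚ)
import Data.Rational.Properties as ℚₚ
open import Data.List using (List; []; _∷_; _∷ʳ_; _++_; map; foldr; length; cartesianProductWith)
open import Data.List.Properties using (map-∘; map-cong; map-++)
open import Data.List.Relation.Unary.All as All using (All; []; _∷_)
import Data.List.Relation.Unary.All.Properties as Allₚ
open import Data.Nat.ListAction using (sum)
open import Data.Product using (_×_; _,_; proj₁; proj₂)
open import Data.Sum using (_⊎_; inj₁; inj₂)
open import Relation.Binary.PropositionalEquality using (_≡_; refl; sym; trans; cong; cong₂)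

-- The variables are y₀, y₁, y₂, …; below yₖ plays the role of x̂_{b+k}.
-- A list a₀ ∷ a₁ ∷ … ∷ [] stands for the monomial y₀^a₀ y₁^a₁ ⋯, so lists that
-- differ only in trailing zeros stand for the same monomial.
Monomial : Set
Monomial = List ℕ

exponent : Monomial → ℕ → ℕ
exponent []      k       = 0
exponent (a ∷ α) zero    = a
exponent (a ∷ α) (suc k) = exponent α k

degree : Monomial → ℕ
degree = sum

-- Multiplication of a monomial by yₖ.
raise : ℕ → Monomial → Monomial
raise zero    []      = 1 ∷ []
raise zero    (a ∷ α) = suc a ∷ α
raise (suc k) []      = 0 ∷ raise k []
raise (suc k) (a ∷ α) = a ∷ raise k α

-- A formal power series over ℚ in y₀, y₁, … is an arbitrary function from
-- monomials to ℚ; `compatible` says that it only depends on the monomial.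
record Series : Set where
  constructor series
  field
    coeff      : Monomial → ℚ
    compatible : ∀ α → coeff (α ∷ʳ 0) ≡ coeff α

open Series public

infix 4 _≈_

_≈_ : Series → Series → Set
f ≈ g = ∀ α → coeff f α ≡ coeff g α

constantTerm : Series → ℚ
constantTerm f = coeff f []

0ₛ : Series
0ₛ = series (λ _ → 0ℚ) (λ _ → refl)

1-coeff : Monomial → ℚ
1-coeff []          = 1ℚ
1-coeff (zero  ∷ α) = 1-coeff α
1-coeff (suc _ ∷ α) = 0ℚ

1-compatible : ∀ α → 1-coeff (α ∷ʳ 0) ≡ 1-coeff α
1-compatible []          = refl
1-compatible (zero  ∷ α) = 1-compatible α
1-compatible (suc _ ∷ α) = refl

1ₛ : Series
1ₛ = series 1-coeff 1-compatible

y-coeff : ℕ → Monomial → ℚ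
y-coeff _       []                = 0ℚ
y-coeff zero    (zero        ∷ α) = 0ℚ
y-coeff zero    (suc zero    ∷ α) = 1-coeff α
y-coeff zero    (suc (suc _) ∷ α) = 0ℚ
y-coeff (suc k) (zero        ∷ α) = y-coeff k α
y-coeff (suc k) (suc _       ∷ α) = 0ℚ

y-compatible : ∀ k α → y-coeff k (α ∷ʳ 0) ≡ y-coeff k α
y-compatible zero    []                = refl
y-compatible (suc k) []                = refl
y-compatible zero    (zero        ∷ α) = refl
y-compatible zero    (suc zero    ∷ α) = 1-compatible α
y-compatible zero    (suc (suc _) ∷ α) = refl
y-compatible (suc k) (zero        ∷ α) = y-compatible k α
y-compatible (suc k) (suc _       ∷ α) = refl

y : ℕ → Series
y k = series (y-coeff k) (y-compatible k)

infixl 6 _-ₛ_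
infixl 7 _*ₛ_
infixr 7 _·ₛ_
infixr 8 _^ₛ_

_-ₛ_ : Series → Series → Series
f -ₛ g = series (λ α → coeff f α ℚ.- coeff g α)
                (λ α → cong₂ ℚ._-_ (compatible f α) (compatible g α))

_·ₛ_ : ℚ → Series → Series
c ·ₛ f = series (λ α → c ℚ.* coeff f α) (λ α → cong (c ℚ.*_) (compatible f α))

-- All pairs (i , j) with i + j = a.
splitsℕ : ℕ → List (ℕ × ℕ)
splitsℕ zero    = (0 , 0) ∷ []
splitsℕ (suc a) = (0 , suc a) ∷ map (λ (i , j) → suc i , j) (splitsℕ a)

consPair : ℕ × ℕ → Monomial × Monomial → Monomial × Monomial
consPair (i , j) (β , γ) = i ∷ β , j ∷ γ

-- All factorisations of a monomial α as a product β γ.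
splits : Monomial → List (Monomial × Monomial)
splits []      = ([] , []) ∷ []
splits (a ∷ α) = cartesianProductWith consPair (splitsℕ a) (splits α)

sumℚ : List ℚ → ℚ
sumℚ = foldr ℚ._+_ 0ℚ

*-coeff : (f g : Monomial → ℚ) → Monomial → ℚ
*-coeff f g α = sumℚ (map (λ (β , γ) → f β ℚ.* g γ) (splits α))

pad : Monomial × Monomial → Monomial × Monomial
pad (β , γ) = β ∷ʳ 0 , γ ∷ʳ 0

consPair-pad : ∀ ps qs → cartesianProductWith consPair ps (map pad qs)
                       ≡ map pad (cartesianProductWith consPair ps qs)
consPair-pad []       qs = refl
consPair-pad (p ∷ ps) qs = trans
  (cong₂ _++_ (trans (sym (map-∘ qs)) (map-∘ qs)) (consPair-pad ps qs))
  (sym (map-++ pad (map (consPair p) qs) _))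

splits-∷ʳ : ∀ α → splits (α ∷ʳ 0) ≡ map pad (splits α)
splits-∷ʳ []      = refl
splits-∷ʳ (a ∷ α) = trans
  (cong (cartesianProductWith consPair (splitsℕ a)) (splits-∷ʳ α))
  (consPair-pad (splitsℕ a) (splits α))

_*ₛ_ : Series → Series → Series
f *ₛ g = series (*-coeff (coeff f) (coeff g)) λ α →
  cong sumℚ (trans (cong (map _) (splits-∷ʳ α))
            (trans (sym (map-∘ (splits α)))
                   (map-cong (λ (β , γ) → cong₂ ℚ._*_ (compatible f β) (compatible g γ)) (splits α))))

_^ₛ_ : Series → ℕ → Series
f ^ₛ zero  = 1ₛ
f ^ₛ suc n = f *ₛ f ^ₛ n

raise-∷ʳ : ∀ k α → raise k (α ∷ʳ 0) ≡ raise k α ⊎ raise k (α ∷ʳ 0) ≡ raise k α ∷ʳ 0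
raise-∷ʳ zero    []      = inj₁ refl
raise-∷ʳ (suc k) []      = inj₁ refl
raise-∷ʳ zero    (a ∷ α) = inj₂ refl
raise-∷ʳ (suc k) (a ∷ α) with raise-∷ʳ k α
... | inj₁ eq = inj₁ (cong (a ∷_) eq)
... | inj₂ eq = inj₂ (cong (a ∷_) eq)

exponent-∷ʳ : ∀ α k → exponent (α ∷ʳ 0) k ≡ exponent α k
exponent-∷ʳ []      zero    = refl
exponent-∷ʳ []      (suc k) = refl
exponent-∷ʳ (a ∷ α) zero    = refl
exponent-∷ʳ (a ∷ α) (suc k) = exponent-∷ʳ α k

coeff-raise-∷ʳ : ∀ f k α → coeff f (raise k (α ∷ʳ 0)) ≡ coeff f (raise k α)
coeff-raise-∷ʳ f k α with raise-∷ʳ k α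
... | inj₁ eq = cong (coeff f) eq
... | inj₂ eq = trans (cong (coeff f) eq) (compatible f (raise k α))

-- Partial derivative with respect to yₖ.
∂ : ℕ → Series → Series
∂ k f = series (λ α → (+ suc (exponent α k)) ℚ./ 1 ℚ.* coeff f (raise k α)) λ α →
  cong₂ (λ e c → (+ suc e) ℚ./ 1 ℚ.* c) (exponent-∷ʳ α k) (coeff-raise-∷ʳ f k α)

Σ< : ℕ → (ℕ → ℚ) → ℚ
Σ< zero    c = 0ℚ
Σ< (suc n) c = Σ< n c ℚ.+ c n

-- An infinite family can be summed when every monomial occurs in only finitely
-- many of its members.
record Summable (F : ℕ → Series) : Set where
  field
    bound  : Monomial → ℕ
    vanish : ∀ α {k} → bound α ≤ k → coeff (F k) α ≡ 0ℚ

open Summable public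

Σ<-cong : ∀ n {c d : ℕ → ℚ} → (∀ k → c k ≡ d k) → Σ< n c ≡ Σ< n d
Σ<-cong zero    eq = refl
Σ<-cong (suc n) eq = cong₂ ℚ._+_ (Σ<-cong n eq) (eq n)

Σ<-stable : ∀ (c : ℕ → ℚ) m n → (∀ {k} → m ≤ k → c k ≡ 0ℚ) → Σ< (n ℕ.+ m) c ≡ Σ< m c
Σ<-stable c m zero    v = refl
Σ<-stable c m (suc n) v = trans
  (cong₂ ℚ._+_ (Σ<-stable c m n v) (v (ℕₚ.m≤n+m m n))) (ℚₚ.+-identityʳ _)

Σ<-unique : ∀ (c : ℕ → ℚ) m n → (∀ {k} → m ≤ k → c k ≡ 0ℚ) → (∀ {k} → n ≤ k → c k ≡ 0ℚ) →
            Σ< m c ≡ Σ< n c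
Σ<-unique c m n v w = trans (sym (Σ<-stable c m n v))
  (trans (cong (λ s → Σ< s c) (ℕₚ.+-comm n m)) (Σ<-stable c n m w))

-- The coefficientwise sum F 0 + F 1 + F 2 + ⋯; by Σ<-unique it does not depend
-- on the choice of bounds.
Σ∞ : (F : ℕ → Series) → Summable F → Series
Σ∞ F s = series (λ α → Σ< (bound s α) (λ k → coeff (F k) α)) λ α →
  trans (Σ<-cong (bound s (α ∷ʳ 0)) (λ k → compatible (F k) α))
        (Σ<-unique (λ k → coeff (F k) α) (bound s (α ∷ʳ 0)) (bound s α)
          (λ {k} le → trans (sym (compatible (F k) α)) (vanish s (α ∷ʳ 0) le))
          (vanish s α))

splitsℕ-sum : ∀ a → All (λ (i , j) → i ℕ.+ j ≡ a) (splitsℕ a)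
splitsℕ-sum zero    = refl ∷ []
splitsℕ-sum (suc a) = refl ∷ Allₚ.map⁺ (All.map (cong suc) (splitsℕ-sum a))

All-consPair : ∀ {P : ℕ × ℕ → Set} {Q R : Monomial × Monomial → Set} →
               (∀ {p q} → P p → Q q → R (consPair p q)) →
               ∀ {ps qs} → All P ps → All Q qs → All R (cartesianProductWith consPair ps qs)
All-consPair f []         qs = []
All-consPair f (p ∷ ps) qs = Allₚ.++⁺ (Allₚ.map⁺ (All.map (f p) qs)) (All-consPair f ps qs)

splits-degree : ∀ α → All (λ (β , γ) → degree β ℕ.+ degree γ ≡ degree α) (splits α)
splits-degree []      = refl ∷ []
splits-degree (a ∷ α) = All-consPair
  (λ {(i , j)} {(β , γ)} p q →
    trans (interchange i (degree β) j (degree γ)) (cong₂ ℕ._+_ p q))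
  (splitsℕ-sum a) (splits-degree α)
  where
  interchange : ∀ i b j c → (i ℕ.+ b) ℕ.+ (j ℕ.+ c) ≡ (i ℕ.+ j) ℕ.+ (b ℕ.+ c)
  interchange i b j c = trans (ℕₚ.+-assoc i b (j ℕ.+ c))
    (trans (cong (i ℕ.+_) (trans (sym (ℕₚ.+-assoc b j c))
      (trans (cong (ℕ._+ c) (ℕₚ.+-comm b j)) (ℕₚ.+-assoc j b c))))
    (sym (ℕₚ.+-assoc i j (b ℕ.+ c))))

splits-length : ∀ α → All (λ (β , γ) → length γ ≡ length α) (splits α)
splits-length []      = refl ∷ []
splits-length (a ∷ α) = All-consPair (λ _ q → cong suc q) (splitsℕ-sum a) (splits-length α)

sumℚ-zero : ∀ {A : Set} (h : A → ℚ) {xs} → All (λ x → h x ≡ 0ℚ) xs → sumℚ (map h xs) ≡ 0ℚ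
sumℚ-zero h []       = refl
sumℚ-zero h (p ∷ ps) = trans (cong₂ ℚ._+_ p (sumℚ-zero h ps)) (ℚₚ.+-identityˡ 0ℚ)

degree-zero : ∀ f → constantTerm f ≡ 0ℚ → ∀ α → degree α ≡ 0 → coeff f α ≡ 0ℚ
degree-zero f f₀ []          _ = f₀
degree-zero f f₀ (zero ∷ α) d = degree-zero
  (series (λ β → coeff f (0 ∷ β)) (λ β → compatible f (0 ∷ β))) (trans (compatible f []) f₀) α d

^-vanish : ∀ f → constantTerm f ≡ 0ℚ → ∀ p α → degree α < p → coeff (f ^ₛ p) α ≡ 0ℚ
^-vanish f f₀ (suc p) α (s≤s d≤p) = sumℚ-zero _ (All.map (λ {x} → term x) (splits-degree α))
  where
  term : ∀ x → degree (proj₁ x) ℕ.+ degree (proj₂ x) ≡ degree α →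
         coeff f (proj₁ x) ℚ.* coeff (f ^ₛ p) (proj₂ x) ≡ 0ℚ
  term (β , γ) eq with degree β in dβ
  ... | zero  = trans (cong (ℚ._* coeff (f ^ₛ p) γ) (degree-zero f f₀ β dβ)) (ℚₚ.*-zeroˡ (coeff (f ^ₛ p) γ))
  ... | suc d = trans (cong (coeff f β ℚ.*_) (^-vanish f f₀ p γ
                  (ℕₚ.≤-trans (s≤s (ℕₚ.m≤n+m (degree γ) d)) (ℕₚ.≤-trans (ℕₚ.≤-reflexive eq) d≤p))))
                  (ℚₚ.*-zeroʳ (coeff f β))

y-vanish : ∀ k α → length α ≤ k → y-coeff k α ≡ 0ℚ
y-vanish k       []          _       = refl
y-vanish (suc k) (zero  ∷ α) (s≤s l) = y-vanish k α l
y-vanish (suc k) (suc _ ∷ α) _       = refl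

*y-summable : ∀ (F : ℕ → Series) → Summable (λ k → F k *ₛ y k)
*y-summable F = record
  { bound  = length
  ; vanish = λ α {k} l → sumℚ-zero _ (All.map
      (λ {(β , γ)} eq → trans
        (cong (coeff (F k) β ℚ.*_) (y-vanish k γ (ℕₚ.≤-trans (ℕₚ.≤-reflexive eq) l)))
        (ℚₚ.*-zeroʳ (coeff (F k) β)))
      (splits-length α)) }

-- Formal power series in the single variable r, as coefficient sequences.
Series₁ : Set
Series₁ = ℕ → ℚ

powers-summable : ∀ (c : Series₁) (R : Series) → constantTerm R ≡ 0ℚ →
                  Summable (λ p → c p ·ₛ R ^ₛ p)
powers-summable c R R₀ = record
  { bound  = λ α → suc (degree α)
  ; vanish = λ α {p} d<p → trans (cong (c p ℚ.*_) (^-vanish R R₀ p α d<p)) (ℚₚ.*-zeroʳ (c p)) }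

-- Substitution of R for r.
infix 9 _[_,_]

_[_,_] : Series₁ → (R : Series) → constantTerm R ≡ 0ℚ → Series
c [ R , R₀ ] = Σ∞ (λ p → c p ·ₛ R ^ₛ p) (powers-summable c R R₀)

Π< : ℕ → (ℕ → ℤ) → ℤ
Π< zero    c = + 1
Π< (suc n) c = Π< n c ℤ.* c n

I : ℕ → ℕ → Series₁
I b ℓ p = (Π< p λ m → (+ ℓ) ℤ.^ 2 ℤ.- (+ b ℤ.- + m) ℤ.^ 2) ℚ./ (p ! ℕ.* p !)
  where instance _ = p !* p !≢0

-- With p = suc q: the sign is (-1)^(p+1), the denominator is p! (p-1)!, and the
-- product runs over 0 ≤ m ≤ p-2.
J : ℕ → Series₁
J b zero    = 0ℚ
J b (suc q) =
  (-[1+ 0 ] ℤ.^ (suc q ℕ.+ 1) ℤ.* Π< q λ m → (+ b ℤ.- + m) ℤ.* (+ b ℤ.- + m ℤ.- + 1))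
    ℚ./ (suc q ! ℕ.* q !)
  where instance _ = suc q !* q !≢0

-- ∂R̂/∂x̂_ℓ for a series R̂ in x̂_b, x̂_{b+1}, …; only meaningful for b ≤ ℓ.
∂/∂x̂ : (b ℓ : ℕ) → Series → Series
∂/∂x̂ b ℓ = ∂ (ℓ ∸ b)

-- ∑_{ℓ ≥ b} F_ℓ x̂_ℓ, written with ℓ = b + k.
Σ-x̂ : (b : ℕ) → (ℕ → Series) → Series
Σ-x̂ b F = Σ∞ (λ k → F (b ℕ.+ k) *ₛ y k) (*y-summable (λ k → F (b ℕ.+ k)))

-- The conditions that characterise R̂^(b).
record IsR̂ (b : ℕ) (R : Series) : Set where
  field
    constantTerm≡0 : constantTerm R ≡ 0ℚ
    equation       : J b [ R , constantTerm≡0 ] -ₛ Σ-x̂ b (λ ℓ → I b ℓ [ R , constantTerm≡0 ]) ≈ 0ₛ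

open IsR̂ public

{-# OPTIONS --safe #-}

-- Put U = J′(R̂) − Σ_ℓ I′(b,ℓ;R̂) x̂_ℓ. Differentiating the defining equation with
-- respect to x̂_ℓ gives U ∂R̂/∂x̂_ℓ = I(b,ℓ;R̂). Since I(b,b;r) = 1, in particular
-- U ∂R̂/∂x̂_b = 1, so ∂R̂/∂x̂_ℓ = U (∂R̂/∂x̂_b) (∂R̂/∂x̂_ℓ) = I(b,ℓ;R̂) ∂R̂/∂x̂_b.

module Submission where

open import Data.Nat as ℕ using (ℕ; zero; suc; _≤_; _<_; z≤n; s≤s)
import Data.Nat.Properties as ℕₚ
import Data.Integer as ℤ
import Data.Integer.Properties as ℤₚ
open import Data.Rational as ℚ using (ℚ; 0ℚ; 1ℚ; _+_; _*_)
import Data.Rational.Properties as ℚₚ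
import Data.Rational.Unnormalised as ℚᵘ
import Data.Rational.Unnormalised.Properties as ℚᵘₚ
open import Data.List using (List; []; _∷_; _∷ʳ_; _++_; map; length; cartesianProductWith)
open import Data.List.Properties using (map-∘; length-++)
open import Data.List.Relation.Unary.All as All using (All; []; _∷_)
open import Data.Product using (∃; _,_)
open import Data.Empty using (⊥-elim)
open import Relation.Binary.PropositionalEquality using (_≡_; _≢_; _≗_; refl; sym; trans; cong; cong₂; subst; module ≡-Reasoning)
open import Algebra.Properties.CommutativeSemigroup using (interchange; x∙yz≈y∙xz)
open import Algebra.Properties.Group ℚₚ.+-0-group using (x∙y⁻¹≈ε⇒x≈y; ∙-cancelʳ; //-rightDividesˡ)
open import Algebra.Bundles using (CommutativeMonoid)
open import Defs

open ≡-Reasoning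

private
  variable
    A B C : Set

-- Arithmetic of rational numbers

+-interchange : ∀ p q r s → (p + q) + (r + s) ≡ (p + r) + (q + s)
+-interchange = interchange (CommutativeMonoid.commutativeSemigroup ℚₚ.+-0-commutativeMonoid)

*-exchange : ∀ p q r → p * (q * r) ≡ q * (p * r)
*-exchange = x∙yz≈y∙xz (CommutativeMonoid.commutativeSemigroup ℚₚ.*-1-commutativeMonoid)

fromℕ : ℕ → ℚ
fromℕ n = (ℤ.+ n) ℚ./ 1

-- The normalisation hidden in `ℚ._/_` is stuck on a variable numerator, so the equation is
-- transported to unnormalised rationals, where all the denominators are 1.
fromℕ-+ : ∀ m n → fromℕ (m ℕ.+ n) ≡ fromℕ m + fromℕ n
fromℕ-+ m n = ℚₚ.toℚᵘ-injective
  (ℚᵘₚ.≃-trans (ℚₚ.toℚᵘ-fromℚᵘ (ℚᵘ.mkℚᵘ (ℤ.+ (m ℕ.+ n)) 0))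
  (ℚᵘₚ.≃-trans (ℚᵘ.*≡* (cong (ℤ._* ℤ.+ 1)
      (sym (cong₂ ℤ._+_ (ℤₚ.*-identityʳ (ℤ.+ m)) (ℤₚ.*-identityʳ (ℤ.+ n))))))
  (ℚᵘₚ.≃-trans (ℚᵘₚ.≃-sym (ℚᵘₚ.+-cong (ℚₚ.toℚᵘ-fromℚᵘ (ℚᵘ.mkℚᵘ (ℤ.+ m) 0))
                                       (ℚₚ.toℚᵘ-fromℚᵘ (ℚᵘ.mkℚᵘ (ℤ.+ n) 0))))
  (ℚᵘₚ.≃-sym (ℚₚ.toℚᵘ-homo-+ (fromℕ m) (fromℕ n))))))

-- Finite sums

∑ : List A → (A → ℚ) → ℚ
∑ xs f = sumℚ (map f xs)

∑-congAll : ∀ {f g : A → ℚ} {xs} → All (λ x → f x ≡ g x) xs → ∑ xs f ≡ ∑ xs g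
∑-congAll []       = refl
∑-congAll (p ∷ ps) = cong₂ _+_ p (∑-congAll ps)

∑-cong : ∀ (xs : List A) {f g : A → ℚ} → f ≗ g → ∑ xs f ≡ ∑ xs g
∑-cong xs eq = ∑-congAll (All.universal eq xs)

∑-0 : ∀ (xs : List A) → ∑ xs (λ _ → 0ℚ) ≡ 0ℚ
∑-0 xs = sumℚ-zero (λ _ → 0ℚ) (All.universal (λ _ → refl) xs)

∑-+ : ∀ (xs : List A) (f g : A → ℚ) → ∑ xs (λ x → f x + g x) ≡ ∑ xs f + ∑ xs g
∑-+ []       f g = refl
∑-+ (x ∷ xs) f g = trans (cong ((f x + g x) +_) (∑-+ xs f g))
                         (+-interchange (f x) (g x) (∑ xs f) (∑ xs g))

∑-*ˡ : ∀ (xs : List A) c (f : A → ℚ) → ∑ xs (λ x → c * f x) ≡ c * ∑ xs f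
∑-*ˡ []       c f = sym (ℚₚ.*-zeroʳ c)
∑-*ˡ (x ∷ xs) c f = trans (cong (c * f x +_) (∑-*ˡ xs c f))
                          (sym (ℚₚ.*-distribˡ-+ c (f x) (∑ xs f)))

∑-*ʳ : ∀ (xs : List A) (f : A → ℚ) c → ∑ xs (λ x → f x * c) ≡ ∑ xs f * c
∑-*ʳ xs f c = trans (∑-cong xs (λ x → ℚₚ.*-comm (f x) c))
                    (trans (∑-*ˡ xs c f) (ℚₚ.*-comm c (∑ xs f)))

∑-++ : ∀ (xs ys : List A) (f : A → ℚ) → ∑ (xs ++ ys) f ≡ ∑ xs f + ∑ ys f
∑-++ []       ys f = sym (ℚₚ.+-identityˡ _)
∑-++ (x ∷ xs) ys f = trans (cong (f x +_) (∑-++ xs ys f)) (sym (ℚₚ.+-assoc (f x) _ _))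

∑-map : ∀ (g : A → B) (xs : List A) (f : B → ℚ) → ∑ (map g xs) f ≡ ∑ xs (λ x → f (g x))
∑-map g xs f = cong sumℚ (sym (map-∘ xs))

∑-swap : ∀ (xs : List A) (ys : List B) (f : A → B → ℚ) →
         ∑ xs (λ x → ∑ ys (f x)) ≡ ∑ ys (λ y → ∑ xs (λ x → f x y))
∑-swap []       ys f = sym (∑-0 ys)
∑-swap (x ∷ xs) ys f = trans (cong (∑ ys (f x) +_) (∑-swap xs ys f))
                             (sym (∑-+ ys (f x) (λ y → ∑ xs (λ x → f x y))))

∑-cartesianProductWith : ∀ (p : A → B → C) (xs : List A) (ys : List B) (f : C → ℚ) →
  ∑ (cartesianProductWith p xs ys) f ≡ ∑ xs (λ x → ∑ ys (λ y → f (p x y)))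
∑-cartesianProductWith p []       ys f = refl
∑-cartesianProductWith p (x ∷ xs) ys f = trans (∑-++ (map (p x) ys) _ f)
  (cong₂ _+_ (∑-map (p x) ys f) (∑-cartesianProductWith p xs ys f))

-- Sums over factorisations of a monomial

∑ₙ : ℕ → (ℕ → ℕ → ℚ) → ℚ
∑ₙ a h = ∑ (splitsℕ a) (λ (i , j) → h i j)

∑ₙ-cong : ∀ a {h k : ℕ → ℕ → ℚ} → (∀ i j → h i j ≡ k i j) → ∑ₙ a h ≡ ∑ₙ a k
∑ₙ-cong a eq = ∑-cong (splitsℕ a) (λ (i , j) → eq i j)

∑ₙ-+ : ∀ a h k → ∑ₙ a (λ i j → h i j + k i j) ≡ ∑ₙ a h + ∑ₙ a k
∑ₙ-+ a h k = ∑-+ (splitsℕ a) _ _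

∑ₙ-suc : ∀ a h → ∑ₙ (suc a) h ≡ h 0 (suc a) + ∑ₙ a (λ i j → h (suc i) j)
∑ₙ-suc a h = cong (h 0 (suc a) +_) (∑-map _ (splitsℕ a) _)

-- `splitsℕ` is built by splitting off the pair with first component 0. Symmetry and the Leibniz
-- rule also need the other end of the list, where the second component is 0.
∑ₙ-sucʳ : ∀ a h → ∑ₙ (suc a) h ≡ ∑ₙ a (λ i j → h i (suc j)) + h (suc a) 0
∑ₙ-sucʳ zero    h = begin
  h 0 1 + (h 1 0 + 0ℚ)  ≡⟨ cong (h 0 1 +_) (ℚₚ.+-identityʳ (h 1 0)) ⟩
  h 0 1 + h 1 0         ≡⟨ cong (_+ h 1 0) (ℚₚ.+-identityʳ (h 0 1)) ⟨
  h 0 1 + 0ℚ + h 1 0    ∎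
∑ₙ-sucʳ (suc a) h = begin
  ∑ₙ (suc (suc a)) h
    ≡⟨ ∑ₙ-suc (suc a) h ⟩
  h 0 (suc (suc a)) + ∑ₙ (suc a) (λ i j → h (suc i) j)
    ≡⟨ cong (h 0 (suc (suc a)) +_) (∑ₙ-sucʳ a (λ i j → h (suc i) j)) ⟩
  h 0 (suc (suc a)) + (∑ₙ a (λ i j → h (suc i) (suc j)) + h (suc (suc a)) 0)
    ≡⟨ ℚₚ.+-assoc (h 0 (suc (suc a))) _ _ ⟨
  h 0 (suc (suc a)) + ∑ₙ a (λ i j → h (suc i) (suc j)) + h (suc (suc a)) 0
    ≡⟨ cong (_+ h (suc (suc a)) 0) (∑ₙ-suc a (λ i j → h i (suc j))) ⟨
  ∑ₙ (suc a) (λ i j → h i (suc j)) + h (suc (suc a)) 0 ∎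

-- Exchanging the components turns the first pair of the list into the last, so one side is unfolded
-- by `∑ₙ-suc` and the other by `∑ₙ-sucʳ`.
∑ₙ-comm : ∀ a h → ∑ₙ a h ≡ ∑ₙ a (λ i j → h j i)
∑ₙ-comm zero    h = refl
∑ₙ-comm (suc a) h = begin
  ∑ₙ (suc a) h                                ≡⟨ ∑ₙ-suc a h ⟩
  h 0 (suc a) + ∑ₙ a (λ i j → h (suc i) j)    ≡⟨ cong (h 0 (suc a) +_) (∑ₙ-comm a (λ i j → h (suc i) j)) ⟩
  h 0 (suc a) + ∑ₙ a (λ i j → h (suc j) i)    ≡⟨ ℚₚ.+-comm (h 0 (suc a)) _ ⟩
  ∑ₙ a (λ i j → h (suc j) i) + h 0 (suc a)    ≡⟨ ∑ₙ-sucʳ a (λ i j → h j i) ⟨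
  ∑ₙ (suc a) (λ i j → h j i)                  ∎

-- Both sides run over the triples with total `a`. The triples with first entry 0 are separated off
-- on each side; for the others that entry is lowered by one, and induction applies.
∑ₙ-assoc : ∀ a (h : ℕ → ℕ → ℕ → ℚ) →
  ∑ₙ a (λ i k → ∑ₙ i (λ i j → h i j k)) ≡ ∑ₙ a (λ i j → ∑ₙ j (λ j k → h i j k))
∑ₙ-assoc zero    h = refl
∑ₙ-assoc (suc a) h = begin
  ∑ₙ (suc a) (λ i k → ∑ₙ i (λ i j → h i j k))
    ≡⟨ ∑ₙ-suc a (λ i k → ∑ₙ i (λ i j → h i j k)) ⟩
  h 0 0 (suc a) + 0ℚ + ∑ₙ a (λ i k → ∑ₙ (suc i) (λ i j → h i j k))
    ≡⟨ cong₂ _+_ (ℚₚ.+-identityʳ (h 0 0 (suc a))) (trans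
         (∑ₙ-cong a (λ i k → ∑ₙ-suc i (λ i j → h i j k)))
         (∑ₙ-+ a (λ i k → h 0 (suc i) k) (λ i k → ∑ₙ i (λ i j → h (suc i) j k)))) ⟩
  h 0 0 (suc a) + (∑ₙ a (λ i k → h 0 (suc i) k) + ∑ₙ a (λ i k → ∑ₙ i (λ i j → h (suc i) j k)))
    ≡⟨ ℚₚ.+-assoc (h 0 0 (suc a)) _ _ ⟨
  h 0 0 (suc a) + ∑ₙ a (λ i k → h 0 (suc i) k) + ∑ₙ a (λ i k → ∑ₙ i (λ i j → h (suc i) j k))
    ≡⟨ cong₂ _+_ (sym (∑ₙ-suc a (h 0))) (∑ₙ-assoc a (λ i → h (suc i))) ⟩
  ∑ₙ (suc a) (h 0) + ∑ₙ a (λ i j → ∑ₙ j (λ j k → h (suc i) j k))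
    ≡⟨ ∑ₙ-suc a (λ i j → ∑ₙ j (h i)) ⟨
  ∑ₙ (suc a) (λ i j → ∑ₙ j (λ j k → h i j k)) ∎

∑ₘ : Monomial → (Monomial → Monomial → ℚ) → ℚ
∑ₘ α h = ∑ (splits α) (λ (β , γ) → h β γ)

∑ₘ-cong : ∀ α {h k : Monomial → Monomial → ℚ} → (∀ β γ → h β γ ≡ k β γ) → ∑ₘ α h ≡ ∑ₘ α k
∑ₘ-cong α eq = ∑-cong (splits α) (λ (β , γ) → eq β γ)

∑ₘ-∷ : ∀ a α h → ∑ₘ (a ∷ α) h ≡ ∑ₙ a (λ i j → ∑ₘ α (λ β γ → h (i ∷ β) (j ∷ γ)))
∑ₘ-∷ a α h = ∑-cartesianProductWith consPair (splitsℕ a) (splits α) (λ (β , γ) → h β γ)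

∑ₘ-∑ₙ : ∀ α a (h : ℕ → ℕ → Monomial → Monomial → ℚ) →
  ∑ₘ α (λ β γ → ∑ₙ a (λ i j → h i j β γ)) ≡ ∑ₙ a (λ i j → ∑ₘ α (h i j))
∑ₘ-∑ₙ α a h = ∑-swap (splits α) (splitsℕ a) _

∑ₘ-comm : ∀ α h → ∑ₘ α h ≡ ∑ₘ α (λ β γ → h γ β)
∑ₘ-comm []      h = refl
∑ₘ-comm (a ∷ α) h = begin
  ∑ₘ (a ∷ α) h
    ≡⟨ ∑ₘ-∷ a α h ⟩
  ∑ₙ a (λ i j → ∑ₘ α (λ β γ → h (i ∷ β) (j ∷ γ)))
    ≡⟨ ∑ₙ-cong a (λ i j → ∑ₘ-comm α (λ β γ → h (i ∷ β) (j ∷ γ))) ⟩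
  ∑ₙ a (λ i j → ∑ₘ α (λ β γ → h (i ∷ γ) (j ∷ β)))
    ≡⟨ ∑ₙ-comm a _ ⟩
  ∑ₙ a (λ i j → ∑ₘ α (λ β γ → h (j ∷ γ) (i ∷ β)))
    ≡⟨ ∑ₘ-∷ a α (λ β γ → h γ β) ⟨
  ∑ₘ (a ∷ α) (λ β γ → h γ β) ∎

-- After the sums over the tail are moved inside those over the head exponent, `∑ₙ-assoc` regroups
-- the head and induction regroups the tail.
∑ₘ-assoc : ∀ α (h : Monomial → Monomial → Monomial → ℚ) →
  ∑ₘ α (λ β δ → ∑ₘ β (λ β γ → h β γ δ)) ≡ ∑ₘ α (λ β γ → ∑ₘ γ (λ γ δ → h β γ δ))
∑ₘ-assoc []      h = refl
∑ₘ-assoc (a ∷ α) h = begin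
  ∑ₘ (a ∷ α) (λ β δ → ∑ₘ β (λ β γ → h β γ δ))
    ≡⟨ ∑ₘ-∷ a α _ ⟩
  ∑ₙ a (λ i k → ∑ₘ α (λ β δ → ∑ₘ (i ∷ β) (λ β γ → h β γ (k ∷ δ))))
    ≡⟨ ∑ₙ-cong a (λ i k → trans
         (∑ₘ-cong α (λ β δ → ∑ₘ-∷ i β _))
         (∑ₘ-∑ₙ α i (λ i j β δ → ∑ₘ β (λ β γ → h (i ∷ β) (j ∷ γ) (k ∷ δ))))) ⟩
  ∑ₙ a (λ i k → ∑ₙ i (λ i j → ∑ₘ α (λ β δ → ∑ₘ β (λ β γ → h (i ∷ β) (j ∷ γ) (k ∷ δ)))))
    ≡⟨ ∑ₙ-assoc a (λ i j k → ∑ₘ α (λ β δ → ∑ₘ β (λ β γ → h (i ∷ β) (j ∷ γ) (k ∷ δ)))) ⟩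
  ∑ₙ a (λ i j → ∑ₙ j (λ j k → ∑ₘ α (λ β δ → ∑ₘ β (λ β γ → h (i ∷ β) (j ∷ γ) (k ∷ δ)))))
    ≡⟨ ∑ₙ-cong a (λ i j → ∑ₙ-cong j (λ j k →
         ∑ₘ-assoc α (λ β γ δ → h (i ∷ β) (j ∷ γ) (k ∷ δ)))) ⟩
  ∑ₙ a (λ i j → ∑ₙ j (λ j k → ∑ₘ α (λ β γ → ∑ₘ γ (λ γ δ → h (i ∷ β) (j ∷ γ) (k ∷ δ)))))
    ≡⟨ ∑ₙ-cong a (λ i j → trans
         (∑ₘ-cong α (λ β γ → ∑ₘ-∷ j γ _))
         (∑ₘ-∑ₙ α j (λ j k β γ → ∑ₘ γ (λ γ δ → h (i ∷ β) (j ∷ γ) (k ∷ δ))))) ⟨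
  ∑ₙ a (λ i j → ∑ₘ α (λ β γ → ∑ₘ (j ∷ γ) (λ γ δ → h (i ∷ β) γ δ)))
    ≡⟨ ∑ₘ-∷ a α _ ⟨
  ∑ₘ (a ∷ α) (λ β γ → ∑ₘ γ (λ γ δ → h β γ δ)) ∎

-- i + j = suc a for each term of the left-hand side.
∑ₙ-leibniz : ∀ a h → fromℕ (suc a) * ∑ₙ (suc a) h
  ≡ ∑ₙ a (λ i j → fromℕ (suc i) * h (suc i) j) + ∑ₙ a (λ i j → fromℕ (suc j) * h i (suc j))
∑ₙ-leibniz a h = begin
  fromℕ (suc a) * ∑ₙ (suc a) h
    ≡⟨ ∑-*ˡ (splitsℕ (suc a)) (fromℕ (suc a)) _ ⟨
  ∑ₙ (suc a) (λ i j → fromℕ (suc a) * h i j)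
    ≡⟨ ∑-congAll (All.map (λ {(i , j)} i+j≡a → trans
         (cong (λ n → fromℕ n * h i j) (sym i+j≡a))
         (trans (cong (_* h i j) (fromℕ-+ i j)) (ℚₚ.*-distribʳ-+ (h i j) (fromℕ i) (fromℕ j))))
         (splitsℕ-sum (suc a))) ⟩
  ∑ₙ (suc a) (λ i j → fromℕ i * h i j + fromℕ j * h i j)
    ≡⟨ ∑ₙ-+ (suc a) (λ i j → fromℕ i * h i j) (λ i j → fromℕ j * h i j) ⟩
  ∑ₙ (suc a) (λ i j → fromℕ i * h i j) + ∑ₙ (suc a) (λ i j → fromℕ j * h i j)
    -- The end term split off in each sum carries the factor `fromℕ 0`. Removing it lowers the range
    -- from `suc a` to `a`.
    ≡⟨ cong₂ _+_
         (trans (∑ₙ-suc a (λ i j → fromℕ i * h i j))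
           (trans (cong (_+ lower) (ℚₚ.*-zeroˡ (h 0 (suc a)))) (ℚₚ.+-identityˡ lower)))
         (trans (∑ₙ-sucʳ a (λ i j → fromℕ j * h i j))
           (trans (cong (upper +_) (ℚₚ.*-zeroˡ (h (suc a) 0))) (ℚₚ.+-identityʳ upper))) ⟩
  lower + upper ∎
  where
  lower = ∑ₙ a (λ i j → fromℕ (suc i) * h (suc i) j)
  upper = ∑ₙ a (λ i j → fromℕ (suc j) * h i (suc j))

-- For shorter α the two sides would involve monomials that differ by trailing
-- zeros, which an arbitrary h may distinguish.
∑ₘ-leibniz : ∀ k α → k < length α → ∀ h → fromℕ (suc (exponent α k)) * ∑ₘ (raise k α) h
  ≡ ∑ₘ α (λ β γ → fromℕ (suc (exponent β k)) * h (raise k β) γ)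
  + ∑ₘ α (λ β γ → fromℕ (suc (exponent γ k)) * h β (raise k γ))
∑ₘ-leibniz zero    (a ∷ α) _       h = begin
  fromℕ (suc a) * ∑ₘ (suc a ∷ α) h
    ≡⟨ cong (fromℕ (suc a) *_) (∑ₘ-∷ (suc a) α h) ⟩
  fromℕ (suc a) * ∑ₙ (suc a) (λ i j → ∑ₘ α (λ β γ → h (i ∷ β) (j ∷ γ)))
    ≡⟨ ∑ₙ-leibniz a (λ i j → ∑ₘ α (λ β γ → h (i ∷ β) (j ∷ γ))) ⟩
  ∑ₙ a (λ i j → fromℕ (suc i) * ∑ₘ α (λ β γ → h (suc i ∷ β) (j ∷ γ))) +
  ∑ₙ a (λ i j → fromℕ (suc j) * ∑ₘ α (λ β γ → h (i ∷ β) (suc j ∷ γ)))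
    ≡⟨ cong₂ _+_
         (trans (∑ₘ-∷ a α _) (∑ₙ-cong a (λ i j → ∑-*ˡ (splits α) (fromℕ (suc i)) _)))
         (trans (∑ₘ-∷ a α _) (∑ₙ-cong a (λ i j → ∑-*ˡ (splits α) (fromℕ (suc j)) _))) ⟨
  _ ∎
∑ₘ-leibniz (suc k) (a ∷ α) (s≤s l) h = begin
  c * ∑ₘ (a ∷ raise k α) h
    ≡⟨ cong (c *_) (∑ₘ-∷ a (raise k α) h) ⟩
  c * ∑ₙ a (λ i j → ∑ₘ (raise k α) (λ β γ → h (i ∷ β) (j ∷ γ)))
    ≡⟨ ∑-*ˡ (splitsℕ a) c _ ⟨
  ∑ₙ a (λ i j → c * ∑ₘ (raise k α) (λ β γ → h (i ∷ β) (j ∷ γ)))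
    ≡⟨ ∑ₙ-cong a (λ i j → ∑ₘ-leibniz k α l (λ β γ → h (i ∷ β) (j ∷ γ))) ⟩
  ∑ₙ a (λ i j → ∑ₘ α (λ β γ → fromℕ (suc (exponent β k)) * h (i ∷ raise k β) (j ∷ γ)) +
                ∑ₘ α (λ β γ → fromℕ (suc (exponent γ k)) * h (i ∷ β) (j ∷ raise k γ)))
    ≡⟨ ∑ₙ-+ a _ _ ⟩
  ∑ₙ a (λ i j → ∑ₘ α (λ β γ → fromℕ (suc (exponent β k)) * h (i ∷ raise k β) (j ∷ γ))) +
  ∑ₙ a (λ i j → ∑ₘ α (λ β γ → fromℕ (suc (exponent γ k)) * h (i ∷ β) (j ∷ raise k γ)))
    ≡⟨ cong₂ _+_ (∑ₘ-∷ a α _) (∑ₘ-∷ a α _) ⟨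
  _ ∎
  where c = fromℕ (suc (exponent α k))

-- The algebra of power series

-- The laws of multiplication are stated for bare coefficient functions, so that they apply to
-- slices such as `λ γ → f (j ∷ γ)` and to pointwise sums without a compatibility proof for each.
*-cong : ∀ {f f′ g g′ : Monomial → ℚ} → f ≗ f′ → g ≗ g′ → *-coeff f g ≗ *-coeff f′ g′
*-cong f≗ g≗ α = ∑ₘ-cong α (λ β γ → cong₂ _*_ (f≗ β) (g≗ γ))

*-comm : ∀ f g → *-coeff f g ≗ *-coeff g f
*-comm f g α = trans (∑ₘ-comm α _) (∑ₘ-cong α (λ β γ → ℚₚ.*-comm (f γ) (g β)))

*-assoc : ∀ f g h → *-coeff (*-coeff f g) h ≗ *-coeff f (*-coeff g h)
*-assoc f g h α = begin
  ∑ₘ α (λ β δ → ∑ₘ β (λ β γ → f β * g γ) * h δ)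
    ≡⟨ ∑ₘ-cong α (λ β δ → ∑-*ʳ (splits β) _ (h δ)) ⟨
  ∑ₘ α (λ β δ → ∑ₘ β (λ β γ → f β * g γ * h δ))
    ≡⟨ ∑ₘ-assoc α (λ β γ δ → f β * g γ * h δ) ⟩
  ∑ₘ α (λ β γ → ∑ₘ γ (λ γ δ → f β * g γ * h δ))
    ≡⟨ ∑ₘ-cong α (λ β γ → trans
         (∑ₘ-cong γ (λ γ δ → ℚₚ.*-assoc (f β) (g γ) (h δ))) (∑-*ˡ (splits γ) (f β) _)) ⟩
  ∑ₘ α (λ β γ → f β * ∑ₘ γ (λ γ δ → g γ * h δ)) ∎

*-swapʳ : ∀ f g h → *-coeff (*-coeff f g) h ≗ *-coeff (*-coeff f h) g
*-swapʳ f g h α = begin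
  *-coeff (*-coeff f g) h α  ≡⟨ *-assoc f g h α ⟩
  *-coeff f (*-coeff g h) α  ≡⟨ *-cong {f} (λ _ → refl) (*-comm g h) α ⟩
  *-coeff f (*-coeff h g) α  ≡⟨ *-assoc f h g α ⟨
  *-coeff (*-coeff f h) g α  ∎

*-zeroˡ : ∀ g → *-coeff (λ _ → 0ℚ) g ≗ (λ _ → 0ℚ)
*-zeroˡ g α = trans (∑ₘ-cong α (λ β γ → ℚₚ.*-zeroˡ (g γ))) (∑-0 (splits α))

*-zeroʳ : ∀ f → *-coeff f (λ _ → 0ℚ) ≗ (λ _ → 0ℚ)
*-zeroʳ f α = trans (*-comm f _ α) (*-zeroˡ f α)

-- Since `1-coeff (i ∷ β)` is `1-coeff β` for `i = 0` and 0 otherwise, only the split of the head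
-- exponent with `i = 0` contributes; the tail is handled by induction.
*-identityˡ : ∀ f → *-coeff 1-coeff f ≗ f
*-identityˡ f []      = trans (ℚₚ.+-identityʳ (1ℚ * f [])) (ℚₚ.*-identityˡ (f []))
*-identityˡ f (a ∷ α) = trans (∑ₘ-∷ a α _) (go a (λ j γ → f (j ∷ γ)))
  where
  go : ∀ a (f : ℕ → Monomial → ℚ) →
       ∑ₙ a (λ i j → ∑ₘ α (λ β γ → 1-coeff (i ∷ β) * f j γ)) ≡ f a α
  go zero    f = trans (ℚₚ.+-identityʳ _) (*-identityˡ (f 0) α)
  go (suc a) f = begin
    ∑ₙ (suc a) (λ i j → ∑ₘ α (λ β γ → 1-coeff (i ∷ β) * f j γ))
      ≡⟨ ∑ₙ-suc a (λ i j → ∑ₘ α (λ β γ → 1-coeff (i ∷ β) * f j γ)) ⟩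
    *-coeff 1-coeff (f (suc a)) α + ∑ₙ a (λ i j → *-coeff (λ _ → 0ℚ) (f j) α)
      ≡⟨ cong₂ _+_ (*-identityˡ (f (suc a)) α)
                   (trans (∑ₙ-cong a (λ i j → *-zeroˡ (f j) α)) (∑-0 (splitsℕ a))) ⟩
    f (suc a) α + 0ℚ
      ≡⟨ ℚₚ.+-identityʳ (f (suc a) α) ⟩
    f (suc a) α ∎

*-identityʳ : ∀ f → *-coeff f 1-coeff ≗ f
*-identityʳ f α = trans (*-comm f 1-coeff α) (*-identityˡ f α)

*-scaleˡ : ∀ c f g → *-coeff (λ α → c * f α) g ≗ (λ α → c * *-coeff f g α)
*-scaleˡ c f g α = trans (∑ₘ-cong α (λ β γ → ℚₚ.*-assoc c (f β) (g γ))) (∑-*ˡ (splits α) c _)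

*-scaleʳ : ∀ c f g → *-coeff f (λ α → c * g α) ≗ (λ α → c * *-coeff f g α)
*-scaleʳ c f g α = trans (∑ₘ-cong α (λ β γ → *-exchange (f β) c (g γ))) (∑-*ˡ (splits α) c _)

*-distribʳ-+ : ∀ f g h → *-coeff (λ α → f α + g α) h ≗ (λ α → *-coeff f h α + *-coeff g h α)
*-distribʳ-+ f g h α =
  trans (∑ₘ-cong α (λ β γ → ℚₚ.*-distribʳ-+ (h γ) (f β) (g β))) (∑-+ (splits α) _ _)

-- Partial derivatives

-- Padding keeps the monomial but lengthens the list that represents it, as the length hypothesis of
-- `∑ₘ-leibniz` demands.
appendZeros : ℕ → Monomial → Monomial
appendZeros zero    α = α
appendZeros (suc n) α = appendZeros n α ∷ʳ 0

coeff-appendZeros : ∀ f n α → coeff f (appendZeros n α) ≡ coeff f α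
coeff-appendZeros f zero    α = refl
coeff-appendZeros f (suc n) α = trans (compatible f (appendZeros n α)) (coeff-appendZeros f n α)

≤-length-appendZeros : ∀ n α → n ≤ length (appendZeros n α)
≤-length-appendZeros zero    α = z≤n
≤-length-appendZeros (suc n) α = ℕₚ.≤-trans (s≤s (≤-length-appendZeros n α))
  (ℕₚ.≤-reflexive (sym (trans (length-++ (appendZeros n α)) (ℕₚ.+-comm _ 1))))

-- The product rule is `∑ₘ-leibniz` on a list padded to length greater than `k`. All three series
-- involved are compatible with trailing zeros, so the padding can be removed again.
∂-* : ∀ k f g α → coeff (∂ k (f *ₛ g)) α ≡ coeff (∂ k f *ₛ g) α + coeff (f *ₛ ∂ k g) α
∂-* k f g α = begin
  coeff (∂ k (f *ₛ g)) α
    ≡⟨ coeff-appendZeros (∂ k (f *ₛ g)) (suc k) α ⟨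
  coeff (∂ k (f *ₛ g)) α⁺
    ≡⟨ ∑ₘ-leibniz k α⁺ (≤-length-appendZeros (suc k) α) (λ β γ → coeff f β * coeff g γ) ⟩
  ∑ₘ α⁺ (λ β γ → fromℕ (suc (exponent β k)) * (coeff f (raise k β) * coeff g γ)) +
  ∑ₘ α⁺ (λ β γ → fromℕ (suc (exponent γ k)) * (coeff f β * coeff g (raise k γ)))
    ≡⟨ cong₂ _+_
         (∑ₘ-cong α⁺ (λ β γ → sym (ℚₚ.*-assoc (fromℕ (suc (exponent β k))) (coeff f (raise k β)) (coeff g γ))))
         (∑ₘ-cong α⁺ (λ β γ → *-exchange (fromℕ (suc (exponent γ k))) (coeff f β) (coeff g (raise k γ)))) ⟩
  coeff (∂ k f *ₛ g) α⁺ + coeff (f *ₛ ∂ k g) α⁺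
    ≡⟨ cong₂ _+_ (coeff-appendZeros (∂ k f *ₛ g) (suc k) α)
                 (coeff-appendZeros (f *ₛ ∂ k g) (suc k) α) ⟩
  coeff (∂ k f *ₛ g) α + coeff (f *ₛ ∂ k g) α ∎
  where α⁺ = appendZeros (suc k) α

1-raise : ∀ k α → 1-coeff (raise k α) ≡ 0ℚ
1-raise zero    []          = refl
1-raise zero    (a ∷ α)     = refl
1-raise (suc k) []          = 1-raise k []
1-raise (suc k) (zero ∷ α)  = 1-raise k α
1-raise (suc k) (suc a ∷ α) = refl

∂-1 : ∀ k α → coeff (∂ k 1ₛ) α ≡ 0ℚ
∂-1 k α = trans (cong (fromℕ (suc (exponent α k)) *_) (1-raise k α))
                (ℚₚ.*-zeroʳ (fromℕ (suc (exponent α k))))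

∂-y-≡ : ∀ k α → coeff (∂ k (y k)) α ≡ 1-coeff α
∂-y-≡ zero    []          = refl
∂-y-≡ zero    (zero ∷ α)  = ℚₚ.*-identityˡ (1-coeff α)
∂-y-≡ zero    (suc a ∷ α) = ℚₚ.*-zeroʳ (fromℕ (suc (suc a)))
∂-y-≡ (suc k) []          = ∂-y-≡ k []
∂-y-≡ (suc k) (zero ∷ α)  = ∂-y-≡ k α
∂-y-≡ (suc k) (suc a ∷ α) = ℚₚ.*-zeroʳ (fromℕ (suc (exponent α k)))

y-raise-≢ : ∀ j k → j ≢ k → ∀ α → y-coeff j (raise k α) ≡ 0ℚ
y-raise-≢ zero    zero    j≢k α           = ⊥-elim (j≢k refl)
y-raise-≢ zero    (suc k) j≢k []          = refl
y-raise-≢ zero    (suc k) j≢k (zero ∷ α)  = refl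
y-raise-≢ zero    (suc k) j≢k (suc zero ∷ α)    = 1-raise k α
y-raise-≢ zero    (suc k) j≢k (suc (suc a) ∷ α) = refl
y-raise-≢ (suc j) zero    j≢k []          = refl
y-raise-≢ (suc j) zero    j≢k (a ∷ α)     = refl
y-raise-≢ (suc j) (suc k) j≢k []          = y-raise-≢ j k (λ eq → j≢k (cong suc eq)) []
y-raise-≢ (suc j) (suc k) j≢k (zero ∷ α)  = y-raise-≢ j k (λ eq → j≢k (cong suc eq)) α
y-raise-≢ (suc j) (suc k) j≢k (suc a ∷ α) = refl

∂-y-≢ : ∀ j k → j ≢ k → ∀ α → coeff (∂ k (y j)) α ≡ 0ℚ
∂-y-≢ j k j≢k α =
  trans (cong (fromℕ (suc (exponent α k)) *_) (y-raise-≢ j k j≢k α))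
        (ℚₚ.*-zeroʳ (fromℕ (suc (exponent α k))))

-- By the product rule for `f *ₛ f ^ₛ suc p`, one term is `X` and the other is `fromℕ (suc p) * X`
-- by induction.
∂-^ : ∀ k f p α → coeff (∂ k (f ^ₛ suc p)) α ≡ fromℕ (suc p) * coeff (f ^ₛ p *ₛ ∂ k f) α
∂-^ k f zero α = begin
  coeff (∂ k (f *ₛ 1ₛ)) α
    ≡⟨ ∂-* k f 1ₛ α ⟩
  coeff (∂ k f *ₛ 1ₛ) α + coeff (f *ₛ ∂ k 1ₛ) α
    ≡⟨ cong₂ _+_ (*-comm (coeff (∂ k f)) 1-coeff α)
         (trans (*-cong {coeff f} (λ _ → refl) (∂-1 k) α) (*-zeroʳ (coeff f) α)) ⟩
  coeff (1ₛ *ₛ ∂ k f) α + 0ℚ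
    ≡⟨ ℚₚ.+-identityʳ _ ⟩
  coeff (1ₛ *ₛ ∂ k f) α
    ≡⟨ ℚₚ.*-identityˡ _ ⟨
  1ℚ * coeff (1ₛ *ₛ ∂ k f) α ∎
∂-^ k f (suc p) α = begin
  coeff (∂ k (f *ₛ f ^ₛ suc p)) α
    ≡⟨ ∂-* k f (f ^ₛ suc p) α ⟩
  coeff (∂ k f *ₛ f ^ₛ suc p) α + coeff (f *ₛ ∂ k (f ^ₛ suc p)) α
    ≡⟨ cong₂ _+_ (*-comm (coeff (∂ k f)) (coeff (f ^ₛ suc p)) α) (begin
         coeff (f *ₛ ∂ k (f ^ₛ suc p)) α
           ≡⟨ *-cong {coeff f} (λ _ → refl) (∂-^ k f p) α ⟩
         coeff (f *ₛ (fromℕ (suc p) ·ₛ (f ^ₛ p *ₛ ∂ k f))) α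
           ≡⟨ *-scaleʳ (fromℕ (suc p)) (coeff f) (coeff (f ^ₛ p *ₛ ∂ k f)) α ⟩
         fromℕ (suc p) * coeff (f *ₛ (f ^ₛ p *ₛ ∂ k f)) α
           ≡⟨ cong (fromℕ (suc p) *_) (*-assoc (coeff f) (coeff (f ^ₛ p)) (coeff (∂ k f)) α) ⟨
         fromℕ (suc p) * X ∎) ⟩
  X + fromℕ (suc p) * X
    ≡⟨ cong (_+ fromℕ (suc p) * X) (ℚₚ.*-identityˡ X) ⟨
  1ℚ * X + fromℕ (suc p) * X
    ≡⟨ ℚₚ.*-distribʳ-+ X 1ℚ (fromℕ (suc p)) ⟨
  (1ℚ + fromℕ (suc p)) * X
    -- Here `fromℕ 1` computes to `1ℚ`.
    ≡⟨ cong (_* X) (fromℕ-+ 1 (suc p)) ⟨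
  fromℕ (suc (suc p)) * X ∎
  where X = coeff (f ^ₛ suc p *ₛ ∂ k f) α

-- Infinite sums that are eventually constant

infix 4 _HasSum_

-- This is convergence in the discrete topology. `Σ∞` is tied to the bound in its `Summable` record,
-- whereas here any large enough cutoff serves. Two evaluations of one family can then be equated by
-- `HasSum-unique`, whatever their bounds.
_HasSum_ : (ℕ → ℚ) → ℚ → Set
c HasSum s = ∃ λ N → ∀ {n} → N ≤ n → Σ< n c ≡ s

Σ<-0 : ∀ n → Σ< n (λ _ → 0ℚ) ≡ 0ℚ
Σ<-0 n = Σ<-unique (λ _ → 0ℚ) n 0 (λ _ → refl) (λ _ → refl)

Σ<-+ : ∀ n c d → Σ< n (λ k → c k + d k) ≡ Σ< n c + Σ< n d
Σ<-+ zero    c d = refl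
Σ<-+ (suc n) c d = trans (cong (_+ (c n + d n)) (Σ<-+ n c d))
                         (+-interchange (Σ< n c) (Σ< n d) (c n) (d n))

Σ<-*ˡ : ∀ n a c → Σ< n (λ k → a * c k) ≡ a * Σ< n c
Σ<-*ˡ zero    a c = sym (ℚₚ.*-zeroʳ a)
Σ<-*ˡ (suc n) a c = trans (cong (_+ a * c n) (Σ<-*ˡ n a c))
                          (sym (ℚₚ.*-distribˡ-+ a (Σ< n c) (c n)))

Σ<-suc : ∀ n c → Σ< (suc n) c ≡ c 0 + Σ< n (λ k → c (suc k))
Σ<-suc zero    c = ℚₚ.+-comm 0ℚ (c 0)
Σ<-suc (suc n) c = trans (cong (_+ c (suc n)) (Σ<-suc n c)) (ℚₚ.+-assoc (c 0) _ _)

HasSum-unique : ∀ {c s t} → c HasSum s → c HasSum t → s ≡ t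
HasSum-unique (M , p) (N , q) = trans (sym (p (ℕₚ.m≤m+n M N))) (q (ℕₚ.m≤n+m N M))

HasSum-cong : ∀ {c d s} → c ≗ d → c HasSum s → d HasSum s
HasSum-cong eq (N , p) = N , λ {n} N≤n → trans (sym (Σ<-cong n eq)) (p N≤n)

HasSum-+ : ∀ {c d s t} → c HasSum s → d HasSum t → (λ k → c k + d k) HasSum s + t
HasSum-+ {c} {d} (M , p) (N , q) = M ℕ.+ N , λ {n} M+N≤n → trans (Σ<-+ n c d)
  (cong₂ _+_ (p (ℕₚ.≤-trans (ℕₚ.m≤m+n M N) M+N≤n)) (q (ℕₚ.≤-trans (ℕₚ.m≤n+m N M) M+N≤n)))

HasSum-*ˡ : ∀ a {c s} → c HasSum s → (λ k → a * c k) HasSum a * s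
HasSum-*ˡ a {c} (N , p) = N , λ {n} N≤n → trans (Σ<-*ˡ n a c) (cong (a *_) (p N≤n))

HasSum-*ʳ : ∀ a {c s} → c HasSum s → (λ k → c k * a) HasSum s * a
HasSum-*ʳ a {c} {s} h = subst (_ HasSum_) (ℚₚ.*-comm a s)
  (HasSum-cong (λ k → ℚₚ.*-comm a (c k)) (HasSum-*ˡ a h))

HasSum-∑ : ∀ (xs : List A) {c : A → ℕ → ℚ} {s : A → ℚ} →
           (∀ x → c x HasSum s x) → (λ k → ∑ xs (λ x → c x k)) HasSum ∑ xs s
HasSum-∑ []       h = 0 , λ {n} _ → Σ<-0 n
HasSum-∑ (x ∷ xs) h = HasSum-+ (h x) (HasSum-∑ xs h)

-- This is the index shift of differentiation: the constant term drops out and term `suc p` takes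
-- the place of term `p`.
HasSum-suc : ∀ {c s} → c 0 ≡ 0ℚ → (λ k → c (suc k)) HasSum s → c HasSum s
HasSum-suc {c} {s} c₀ (N , p) = suc N , λ { {suc n} (s≤s N≤n) →
  trans (Σ<-suc n c) (trans (cong₂ _+_ c₀ (p N≤n)) (ℚₚ.+-identityˡ s)) }

HasSum-bounded : ∀ c N → (∀ {k} → N ≤ k → c k ≡ 0ℚ) → c HasSum Σ< N c
HasSum-bounded c N v = N , λ {n} N≤n → Σ<-unique c n N (λ n≤k → v (ℕₚ.≤-trans N≤n n≤k)) v

HasSum-single : ∀ c k → (∀ j → j ≢ k → c j ≡ 0ℚ) → c HasSum c k
HasSum-single c zero    v = subst (c HasSum_) (ℚₚ.+-identityˡ (c 0))
  (HasSum-bounded c 1 (λ { {suc j} _ → v (suc j) (λ ()) }))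
HasSum-single c (suc k) v = HasSum-suc (v 0 (λ ()))
  (HasSum-single (λ j → c (suc j)) k (λ j j≢k → v (suc j) (λ eq → j≢k (ℕₚ.suc-injective eq))))

Σ∞-HasSum : ∀ F (s : Summable F) α → (λ k → coeff (F k) α) HasSum coeff (Σ∞ F s) α
Σ∞-HasSum F s α = HasSum-bounded _ (bound s α) (vanish s α)

-- A coefficient of a product is a finite sum over `splits α`, and each of its terms depends on a
-- single coefficient of `F k`. Hence multiplication by `g` commutes with the infinite sum.
HasSum-*-coeff : ∀ {F : ℕ → Monomial → ℚ} {f} g → (∀ α → (λ k → F k α) HasSum f α) →
                 ∀ α → (λ k → *-coeff (F k) g α) HasSum *-coeff f g α
HasSum-*-coeff g h α = HasSum-∑ (splits α) (λ (β , γ) → HasSum-*ʳ (g γ) (h β))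

-- Substitution and the chain rule

derivative : Series₁ → Series₁
derivative c p = c (suc p) * fromℕ (suc p)

substitute-HasSum : ∀ c R R₀ α → (λ p → c p * coeff (R ^ₛ p) α) HasSum coeff (c [ R , R₀ ]) α
substitute-HasSum c R R₀ = Σ∞-HasSum _ (powers-summable c R R₀)

-- Both sides are sums of the family of derivatives of `c p ·ₛ R ^ₛ p`. The left side is so
-- termwise. On the right, the power rule identifies term `p` with the derivative of term `suc p`,
-- and the derivative of term 0 vanishes.
∂-substitute : ∀ k c R R₀ → ∂ k (c [ R , R₀ ]) ≈ derivative c [ R , R₀ ] *ₛ ∂ k R
∂-substitute k c R R₀ α = HasSum-unique
  (HasSum-*ˡ (fromℕ (suc (exponent α k))) (substitute-HasSum c R R₀ (raise k α)))
  (HasSum-suc constant (HasSum-cong higher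
    (HasSum-*-coeff (coeff (∂ k R)) (substitute-HasSum (derivative c) R R₀) α)))
  where
  scale : ∀ a f → coeff (∂ k (a ·ₛ f)) α ≡ a * coeff (∂ k f) α
  scale a f = *-exchange (fromℕ (suc (exponent α k))) a (coeff f (raise k α))

  constant : coeff (∂ k (c 0 ·ₛ 1ₛ)) α ≡ 0ℚ
  constant = trans (scale (c 0) 1ₛ) (trans (cong (c 0 *_) (∂-1 k α)) (ℚₚ.*-zeroʳ (c 0)))

  higher : ∀ p → coeff ((derivative c p ·ₛ R ^ₛ p) *ₛ ∂ k R) α
               ≡ coeff (∂ k (c (suc p) ·ₛ R ^ₛ suc p)) α
  higher p = begin
    coeff ((derivative c p ·ₛ R ^ₛ p) *ₛ ∂ k R) α
      ≡⟨ *-scaleˡ (derivative c p) (coeff (R ^ₛ p)) (coeff (∂ k R)) α ⟩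
    c (suc p) * fromℕ (suc p) * coeff (R ^ₛ p *ₛ ∂ k R) α
      ≡⟨ ℚₚ.*-assoc (c (suc p)) _ _ ⟩
    c (suc p) * (fromℕ (suc p) * coeff (R ^ₛ p *ₛ ∂ k R) α)
      ≡⟨ cong (c (suc p) *_) (∂-^ k R p α) ⟨
    c (suc p) * coeff (∂ k (R ^ₛ suc p)) α
      ≡⟨ scale (c (suc p)) (R ^ₛ suc p) ⟨
    coeff (∂ k (c (suc p) ·ₛ R ^ₛ suc p)) α ∎

-- The defining equation of R̂

Π<-zero : ∀ n c → c 0 ≡ ℤ.0ℤ → Π< (suc n) c ≡ ℤ.0ℤ
Π<-zero zero    c c₀ = trans (ℤₚ.*-identityˡ (c 0)) c₀
Π<-zero (suc n) c c₀ = trans (cong (ℤ._* c (suc n)) (Π<-zero n c c₀)) (ℤₚ.*-zeroˡ (c (suc n)))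

-- For `ℓ = b` the factor with `m = 0` is `b² - b² = 0`, and it occurs in every nonempty product.
I-diagonal : ∀ b p → I b b (suc p) ≡ 0ℚ
I-diagonal b p = trans
  (cong (λ z → ℚ._/_ z (suc p ℕ.! ℕ.* suc p ℕ.!) {{suc p ℕₚ.!* suc p !≢0}})
    (Π<-zero p _ (trans
      (cong (λ z → (ℤ.+ b) ℤ.^ 2 ℤ.- z ℤ.^ 2) (ℤₚ.+-identityʳ (ℤ.+ b)))
      (ℤₚ.+-inverseʳ ((ℤ.+ b) ℤ.^ 2)))))
  (ℚₚ.0/n≡0 _ {{suc p ℕₚ.!* suc p !≢0}})

I-diagonal-substitute : ∀ b R R₀ → I b b [ R , R₀ ] ≈ 1ₛ
I-diagonal-substitute b R R₀ α = HasSum-unique (substitute-HasSum (I b b) R R₀ α)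
  -- Only the term `p = 0` survives; `I b b 0` computes to `1ℚ` and `R ^ₛ 0` is `1ₛ`.
  (subst (c HasSum_) (ℚₚ.*-identityˡ (1-coeff α)) (HasSum-single c 0 c-vanish))
  where
  c : ℕ → ℚ
  c p = I b b p * coeff (R ^ₛ p) α

  c-vanish : ∀ p → p ≢ 0 → c p ≡ 0ℚ
  c-vanish zero    0≢0 = ⊥-elim (0≢0 refl)
  c-vanish (suc p) _   = trans (cong (_* coeff (R ^ₛ suc p) α) (I-diagonal b p))
                               (ℚₚ.*-zeroˡ (coeff (R ^ₛ suc p) α))

module _ (b : ℕ) (R : Series) (isR̂ : IsR̂ b R) where

  private
    R₀ = constantTerm≡0 isR̂

    I[_] I′[_] : ℕ → Series
    I[ j ]  = I b (b ℕ.+ j) [ R , R₀ ]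
    I′[ j ] = derivative (I b (b ℕ.+ j)) [ R , R₀ ]

  J′R ΣI′y : Series
  J′R  = derivative (J b) [ R , R₀ ]
  ΣI′y = Σ∞ (λ j → I′[ j ] *ₛ y j) (*y-summable I′[_])

  -- The product rule gives two terms for each summand. Those in which the coefficient series is
  -- differentiated have the common factor `∂ k R`; those in which `y j` is differentiated leave
  -- only `j = k`.
  ∂-equation : ∀ k α → coeff (J′R *ₛ ∂ k R) α ≡ coeff (ΣI′y *ₛ ∂ k R) α + coeff I[ k ] α
  ∂-equation k α = begin
    coeff (J′R *ₛ ∂ k R) α
      ≡⟨ ∂-substitute k (J b) R R₀ α ⟨
    coeff (∂ k (J b [ R , R₀ ])) α
      ≡⟨ cong (fromℕ (suc (exponent α k)) *_)
           -- A coefficient of `∂ k` at `α` is a multiple of the coefficient at `raise k α`, so the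
           -- defining equation is used at that one monomial.
           (x∙y⁻¹≈ε⇒x≈y _ _ (equation isR̂ (raise k α))) ⟩
    coeff (∂ k (Σ-x̂ b (λ ℓ → I b ℓ [ R , R₀ ]))) α
      ≡⟨ HasSum-unique
           (HasSum-*ˡ (fromℕ (suc (exponent α k))) (Σ∞-HasSum _ (*y-summable I[_]) (raise k α)))
           (HasSum-cong term (HasSum-+
             (HasSum-*-coeff (coeff (∂ k R)) (Σ∞-HasSum _ (*y-summable I′[_])) α) explicit)) ⟩
    coeff (ΣI′y *ₛ ∂ k R) α + coeff I[ k ] α ∎
    where
    term : ∀ j → coeff ((I′[ j ] *ₛ y j) *ₛ ∂ k R) α + coeff (I[ j ] *ₛ ∂ k (y j)) α
               ≡ coeff (∂ k (I[ j ] *ₛ y j)) α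
    term j = begin
      coeff ((I′[ j ] *ₛ y j) *ₛ ∂ k R) α + rest
        -- `∂ k R` is brought next to `I′[ j ]`, where the chain rule can be read backwards.
        ≡⟨ cong (_+ rest) (*-swapʳ (coeff I′[ j ]) (y-coeff j) (coeff (∂ k R)) α) ⟩
      coeff ((I′[ j ] *ₛ ∂ k R) *ₛ y j) α + rest
        ≡⟨ cong (_+ rest) (*-cong (∂-substitute k (I b (b ℕ.+ j)) R R₀) (λ _ → refl) α) ⟨
      coeff (∂ k I[ j ] *ₛ y j) α + rest
        ≡⟨ ∂-* k I[ j ] (y j) α ⟨
      coeff (∂ k (I[ j ] *ₛ y j)) α ∎
      where rest = coeff (I[ j ] *ₛ ∂ k (y j)) α

    explicit : (λ j → coeff (I[ j ] *ₛ ∂ k (y j)) α) HasSum coeff I[ k ] α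
    explicit = subst ((λ j → coeff (I[ j ] *ₛ ∂ k (y j)) α) HasSum_)
      (trans (*-cong {coeff I[ k ]} (λ _ → refl) (∂-y-≡ k) α) (*-identityʳ (coeff I[ k ]) α))
      (HasSum-single (λ j → coeff (I[ j ] *ₛ ∂ k (y j)) α) k (λ j j≢k → trans
        (*-cong {coeff I[ j ]} (λ _ → refl) (∂-y-≢ j k j≢k) α) (*-zeroʳ (coeff I[ j ]) α)))

  U : Series
  U = J′R -ₛ ΣI′y

  -- With `ΣI′y *ₛ ∂ k R` added to both sides, `U` and `ΣI′y` combine to `J′R` and the claim becomes
  -- `∂-equation`.
  U*∂R : ∀ k → U *ₛ ∂ k R ≈ I[ k ]
  U*∂R k α = ∙-cancelʳ (coeff (ΣI′y *ₛ ∂ k R) α) _ _ (begin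
    coeff (U *ₛ ∂ k R) α + coeff (ΣI′y *ₛ ∂ k R) α
      ≡⟨ *-distribʳ-+ (coeff U) (coeff ΣI′y) (coeff (∂ k R)) α ⟨
    *-coeff (λ β → coeff U β + coeff ΣI′y β) (coeff (∂ k R)) α
      ≡⟨ *-cong (λ β → //-rightDividesˡ (coeff ΣI′y β) (coeff J′R β)) (λ _ → refl) α ⟩
    coeff (J′R *ₛ ∂ k R) α
      ≡⟨ ∂-equation k α ⟩
    coeff (ΣI′y *ₛ ∂ k R) α + coeff I[ k ] α
      ≡⟨ ℚₚ.+-comm _ (coeff I[ k ] α) ⟩
    coeff I[ k ] α + coeff (ΣI′y *ₛ ∂ k R) α ∎)

  U*∂₀R : U *ₛ ∂ 0 R ≈ 1ₛ
  U*∂₀R α = trans (U*∂R 0 α) (trans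
    -- The index `k = 0` stands for `ℓ = b`, but `b ℕ.+ 0` does not reduce to `b`.
    (cong (λ n → coeff (I b n [ R , R₀ ]) α) (ℕₚ.+-identityʳ b)) (I-diagonal-substitute b R R₀ α))

  ∂R≈I*∂₀R : ∀ k → ∂ k R ≈ I[ k ] *ₛ ∂ 0 R
  ∂R≈I*∂₀R k α = begin
    coeff (∂ k R) α                   ≡⟨ *-identityˡ (coeff (∂ k R)) α ⟨
    coeff (1ₛ *ₛ ∂ k R) α             ≡⟨ *-cong U*∂₀R (λ _ → refl) α ⟨
    -- The two derivatives trade places: `U` was introduced as the inverse of `∂ 0 R` and is now
    -- absorbed by `∂ k R`.
    coeff ((U *ₛ ∂ 0 R) *ₛ ∂ k R) α   ≡⟨ *-swapʳ (coeff U) (coeff (∂ 0 R)) (coeff (∂ k R)) α ⟩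
    coeff ((U *ₛ ∂ k R) *ₛ ∂ 0 R) α   ≡⟨ *-cong (U*∂R k) (λ _ → refl) α ⟩
    coeff (I[ k ] *ₛ ∂ 0 R) α         ∎

lemma12 : ∀ (b ℓ : ℕ) → b ≤ ℓ → (R̂ : Series) (isR̂ : IsR̂ b R̂) →
    ∂/∂x̂ b ℓ R̂ ≈ I b ℓ [ R̂ , constantTerm≡0 isR̂ ] *ₛ ∂/∂x̂ b b R̂
lemma12 b ℓ b≤ℓ R̂ isR̂ α = begin
  coeff (∂ (ℓ ℕ.∸ b) R̂) α
    ≡⟨ ∂R≈I*∂₀R b R̂ isR̂ (ℓ ℕ.∸ b) α ⟩
  coeff (I b (b ℕ.+ (ℓ ℕ.∸ b)) [ R̂ , R₀ ] *ₛ ∂ 0 R̂) α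
    -- This translates the offset `k = ℓ ∸ b` back to `ℓ`, and the variable index 0 to `b ∸ b`.
    ≡⟨ cong₂ (λ m n → coeff (I b m [ R̂ , R₀ ] *ₛ ∂ n R̂) α) (ℕₚ.m+[n∸m]≡n b≤ℓ) (sym (ℕₚ.n∸n≡0 b)) ⟩
  coeff (I b ℓ [ R̂ , R₀ ] *ₛ ∂ (b ℕ.∸ b) R̂) α ∎
  where R₀ = constantTerm≡0 isR̂
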